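{- Every connected locally connected $\{K_{1,1,3},K_1+P_4\}$-free graph of order at least $3$ is fully cycle extendable.
   Context: All graphs are finite, simple, and undirected. $n(G)$ is the order of $G$; $N_G(u)$ is the (open) neighborhood of $u$ in $G$. $G$ is locally connected if for every vertex $u$ of $G$ the induced subgraph $G[N_G(u)]$ is connected. $G+H$ denotes the join of disjoint graphs (all edges between them are added to their disjoint union); $K_n$ and $P_n$ are the complete graph and the path of order $n$, $\bar{G}$ is the complement of $G$, and $K_{1,1,3}=K_1+K_1+\bar{K}_3$. For a set ${\cal F}$ of graphs, a graph is ${\cal F}$-free if it contains no graph in ${\cal F}$ as an induced subgraph (up to isomorphism). A cycle $C$ in $G$ is extendable if $G$ contains a cycle $C'$ of order $n(C)+1$ with $V(C)\subseteq V(C')$. $G$ is fully cycle extendable if every vertex of $G$ lies on a triangle and every cycle in $G$ of order less than $n(G)$ is extendable. -}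

module Defs where

open import Data.Fin using (Fin; toℕ; splitAt; _≟_)
open import Data.List using (List; []; _∷_; _∷ʳ_; length)
open import Data.List.Membership.Propositional using (_∈_)
open import Data.List.Relation.Binary.Subset.Propositional using (_⊆_)
open import Data.List.Relation.Unary.Linked using (Linked)
open import Data.List.Relation.Unary.Unique.Propositional using (Unique)
open import Data.Nat using (ℕ; suc; _+_; _≤_; _<_)
import Data.Nat.Properties as ℕ
open import Data.Product using (Σ-syntax; ∃-syntax; _×_; _,_)
open import Data.Refinement using (Refinement-syntax; value)
open import Data.Sum using (_⊎_; inj₁; inj₂; swap)
open import Data.Unit using (⊤; tt)
open import Function using (_∘_; _on_)
open import Function.Bundles using (_⇔_)
open import Function.Definitions using (Injective)
open import Level using (0ℓ)
open import Relation.Binary using (Rel; Symmetric; Irreflexive; Decidable; Universal)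
open import Relation.Binary.Construct.Closure.ReflexiveTransitive using (Star)
open import Relation.Binary.PropositionalEquality using (_≡_; _≢_; refl; sym)
open import Relation.Nullary using (¬_; yes; ¬?; _×-dec_; _⊎-dec_)
open import Relation.Unary using (Pred)

-- Simple undirected graphs with vertex set V.  Finite graphs are those with
-- V = Fin n; other vertex types only arise as subtypes of Fin n, see _[_].
-- Adjacency is decidable, as it classically always is.
record Graph (V : Set) : Set₁ where
  field
    Adj    : Rel V 0ℓ
    Adj?   : Decidable Adj
    symm   : Symmetric Adj
    irrefl : Irreflexive _≡_ Adj

open Graph public

Connected : ∀ {V} → Graph V → Set
Connected G = Universal (Star (Adj G))

-- The induced subgraph G[S].  A refinement type is used rather than Σ V S so
-- that each vertex satisfying S occurs exactly once.
_[_] : ∀ {V} → Graph V → (S : Pred V 0ℓ) → Graph [ v ∈ V ∣ S v ]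
G [ S ] = record
  { Adj    = Adj G on value
  ; Adj?   = λ u v → Adj? G (value u) (value v)
  ; symm   = symm G
  ; irrefl = λ { refl → irrefl G refl }
  }

N : ∀ {V} → Graph V → V → Pred V 0ℓ
N G u v = Adj G u v

LocallyConnected : ∀ {V} → Graph V → Set
LocallyConnected G = ∀ u → Connected (G [ N G u ])

K : ∀ n → Graph (Fin n)
K n = record
  { Adj    = _≢_
  ; Adj?   = λ u v → ¬? (u ≟ v)
  ; symm   = λ u≢v → u≢v ∘ sym
  ; irrefl = λ u≡v u≢v → u≢v u≡v
  }

P : ∀ n → Graph (Fin n)
P n = record
  { Adj    = λ u v → suc (toℕ u) ≡ toℕ v ⊎ suc (toℕ v) ≡ toℕ u
  ; Adj?   = λ u v → (suc (toℕ u) ℕ.≟ toℕ v) ⊎-dec (suc (toℕ v) ℕ.≟ toℕ u)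
  ; symm   = swap
  ; irrefl = λ { refl (inj₁ e) → ℕ.1+n≢n e ; refl (inj₂ e) → ℕ.1+n≢n e }
  }

complement : ∀ {n} → Graph (Fin n) → Graph (Fin n)
complement G = record
  { Adj    = λ u v → u ≢ v × ¬ Adj G u v
  ; Adj?   = λ u v → ¬? (u ≟ v) ×-dec ¬? (Adj? G u v)
  ; symm   = λ (u≢v , ¬uv) → u≢v ∘ sym , ¬uv ∘ symm G
  ; irrefl = λ u≡v (u≢v , _) → u≢v u≡v
  }

module _ {V W : Set} (G : Graph V) (H : Graph W) where

  JoinAdj : Rel (V ⊎ W) 0ℓ
  JoinAdj (inj₁ u) (inj₁ v) = Adj G u v
  JoinAdj (inj₁ _) (inj₂ _) = ⊤
  JoinAdj (inj₂ _) (inj₁ _) = ⊤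
  JoinAdj (inj₂ u) (inj₂ v) = Adj H u v

  joinAdj? : Decidable JoinAdj
  joinAdj? (inj₁ u) (inj₁ v) = Adj? G u v
  joinAdj? (inj₁ _) (inj₂ _) = yes tt
  joinAdj? (inj₂ _) (inj₁ _) = yes tt
  joinAdj? (inj₂ u) (inj₂ v) = Adj? H u v

  joinAdj-sym : Symmetric JoinAdj
  joinAdj-sym {inj₁ _} {inj₁ _} a = symm G a
  joinAdj-sym {inj₁ _} {inj₂ _} _ = tt
  joinAdj-sym {inj₂ _} {inj₁ _} _ = tt
  joinAdj-sym {inj₂ _} {inj₂ _} a = symm H a

  joinAdj-irrefl : ∀ x → ¬ JoinAdj x x
  joinAdj-irrefl (inj₁ _) = irrefl G refl
  joinAdj-irrefl (inj₂ _) = irrefl H refl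

infixl 6 _+ᴳ_

-- The join: the first m vertices of Fin (m + n) carry G, the last n carry H.
_+ᴳ_ : ∀ {m n} → Graph (Fin m) → Graph (Fin n) → Graph (Fin (m + n))
_+ᴳ_ {m} G H = record
  { Adj    = JoinAdj G H on splitAt m
  ; Adj?   = λ u v → joinAdj? G H (splitAt m u) (splitAt m v)
  ; symm   = λ {u} {v} → joinAdj-sym G H {splitAt m u} {splitAt m v}
  ; irrefl = λ { {u} refl → joinAdj-irrefl G H (splitAt m u) }
  }

K₁,₁,₃ : Graph (Fin 5)
K₁,₁,₃ = K 1 +ᴳ K 1 +ᴳ complement (K 3)

K₁+P₄ : Graph (Fin 5)
K₁+P₄ = K 1 +ᴳ P 4

-- H is isomorphic to an induced subgraph of G.
_⊑_ : ∀ {V W} → Graph V → Graph W → Set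
_⊑_ {V} {W} H G =
  Σ[ f ∈ (V → W) ] Injective _≡_ _≡_ f × (∀ u v → Adj H u v ⇔ Adj G (f u) (f v))

FiniteGraph : Set₁
FiniteGraph = ∃[ n ] Graph (Fin n)

_-Free : ∀ {ℓ} → Pred FiniteGraph ℓ → ∀ {n} → Graph (Fin n) → Set _
(𝓕 -Free) G = ∀ m (H : Graph (Fin m)) → 𝓕 (m , H) → ¬ H ⊑ G

-- A cycle is given by its vertices in cyclic order; the choice of starting
-- vertex and orientation is immaterial below.
record Cycle {V : Set} (G : Graph V) : Set where
  field
    start : V
    rest  : List V

  vertices : List V
  vertices = start ∷ rest

  order : ℕ
  order = length vertices

  field
    order≥3  : 3 ≤ order
    distinct : Unique vertices
    closed   : Linked (Adj G) (vertices ∷ʳ start)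

open Cycle public using (vertices; order)

Extendable : ∀ {V} {G : Graph V} → Cycle G → Set
Extendable {G = G} C =
  Σ[ C′ ∈ Cycle G ] order C′ ≡ suc (order C) × vertices C ⊆ vertices C′

OnTriangle : ∀ {V} → Graph V → V → Set
OnTriangle G u = Σ[ C ∈ Cycle G ] order C ≡ 3 × u ∈ vertices C

FullyCycleExtendable : ∀ {n} → Graph (Fin n) → Set
FullyCycleExtendable {n} G =
  (∀ u → OnTriangle G u) × (∀ (C : Cycle G) → order C < n → Extendable C)

{-# OPTIONS --safe #-}

-- Let C be a non-extendable cycle, s⁺ the successor of a vertex s on C, and x a vertex off C
-- adjacent to some vertex of C.  One grows a list of vertices s ~ x of C in which every later
-- vertex w satisfies w ~ s, w ~ s⁺ and w⁺ ≁ s for every earlier s; such a list has no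
-- repetitions, so it cannot grow forever.  To extend a list ending in w, note that the
-- neighbourhood of w is connected and P₄-free, hence of diameter at most 2, so x and w⁺ have a
-- common neighbour v in it.  The vertex v lies on C, as otherwise it could be inserted between w
-- and w⁺.  For an earlier s, the paths s x v w⁺ and s⁺ s v w⁺ in the neighbourhood of w are not
-- induced, which gives v ~ s and v ~ s⁺; here x ≁ w⁺ and s⁺ ≁ w⁺ because C could otherwise be
-- rerouted through x.  Finally v⁺ ≁ s, as otherwise s and v would have the independent common
-- neighbours x, s⁺ and v⁺.

module Submission where

open import Defs
open import Data.Fin as Fin using (Fin; zero; suc; _≟_)
open import Data.Fin.Properties using (<-cmp; any?; injective⇒≤; ¬∀⟶∃¬)
open import Data.Irrelevant using () renaming ([_] to irr)
open import Data.List using (List; []; _∷_; _++_; _∷ʳ_; length; lookup; reverse; tabulate; allFin)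
open import Data.List.Membership.DecPropositional using (_∈?_)
open import Data.List.Membership.Propositional using (_∈_; _∉_)
open import Data.List.Membership.Propositional.Properties using (∈-∃++; ∈-insert; ∈-++⁺ʳ; ∈-++⁻)
open import Data.List.Membership.Setoid.Properties using (index-injective)
open import Data.List.Properties
  using (++-assoc; ∷ʳ-++; ∷ʳ-injective; ∷-injectiveˡ; ∷-injectiveʳ; length-map; reverse-++;
         tabulate-lookup; unfold-reverse)
open import Data.List.Relation.Binary.Permutation.Propositional
  using (_↭_; prep; ↭-refl; ↭-sym; ↭-trans; ↭⇒↭ₛ)
open import Data.List.Relation.Binary.Permutation.Propositional.Properties
  using (shift; zoom; ↭-length; ↭-reverse; ∈-resp-↭; ∷↭∷ʳ)
open import Data.List.Relation.Binary.Permutation.Setoid.Properties using (Unique-resp-↭)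
open import Data.List.Relation.Binary.Subset.DecPropositional using (_⊆?_)
open import Data.List.Relation.Binary.Subset.Propositional using (_⊆_)
open import Data.List.Relation.Unary.All as All using (All; []; _∷_)
import Data.List.Relation.Unary.All.Properties as All
open import Data.List.Relation.Unary.AllPairs as AllPairs using (AllPairs; []; _∷_)
import Data.List.Relation.Unary.AllPairs.Properties as AllPairs
open import Data.List.Relation.Unary.Any using (here; there)
open import Data.List.Relation.Unary.Linked as Linked using (Linked; []; [-]; _∷_; linked?)
open import Data.List.Relation.Unary.Unique.DecPropositional using (unique?)
open import Data.List.Relation.Unary.Unique.Propositional using (Unique)
open import Data.Nat using (ℕ; zero; suc; _≤_; _<_; z≤n; s≤s; _≤?_)
open import Data.Nat.Properties using (<⇒≱; n≮n; m≤n⇒m≤1+n; ≤-refl; ≤-trans; suc-injective)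
open import Data.Product using (∃-syntax; ∃₂; _×_; _,_; proj₁; proj₂)
open import Data.Refinement using (Refinement; _,_; value)
open import Data.Sum as Sum using (_⊎_; inj₁; inj₂)
open import Function using (_∘_)
open import Function.Bundles using (_⇔_; mk⇔; Equivalence)
open import Level using (Level)
open import Relation.Binary using (Rel; Symmetric; tri<; tri≈; tri>)
open import Relation.Binary.Construct.Closure.ReflexiveTransitive using (Star; ε; _◅_)
open import Relation.Binary.PropositionalEquality
  using (_≡_; _≢_; refl; sym; trans; cong; cong₂; subst; setoid; module ≡-Reasoning)
open import Relation.Nullary using (¬_; Dec; yes; no; contradiction; _×-dec_; recompute)
open import Relation.Nullary.Decidable using (True; False; toWitness; toWitnessFalse; map′; decidable-stable)
open import Relation.Unary using (Pred; Decidable; ｛_｝; _∪_)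

private
  variable
    a p r : Level
    A : Set a
    n : ℕ

-- Linked lists, distinct entries and finite search.

module _ {R : Rel A r} where

  allPairs-lookup : ∀ {m} {f : Fin m → A} → AllPairs R (tabulate f) →
                    ∀ {i j} → i Fin.< j → R (f i) (f j)
  allPairs-lookup {suc _} (Rx ∷ _)  {zero}  {suc j} _         = All.tabulate⁻ Rx j
  allPairs-lookup {suc _} (_  ∷ Rs) {suc i} {suc j} (s≤s i<j) = allPairs-lookup Rs i<j

  linked-++ : ∀ xs {y ys} → Linked R (xs ∷ʳ y) → Linked R (y ∷ ys) → Linked R (xs ++ y ∷ ys)
  linked-++ []           _        l = l
  linked-++ (_ ∷ [])     (Rx ∷ _) l = Rx ∷ l
  linked-++ (_ ∷ x ∷ xs) (Rx ∷ k) l = Rx ∷ linked-++ (x ∷ xs) k l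

  linked-++⁻ˡ : ∀ xs {y ys} → Linked R (xs ++ y ∷ ys) → Linked R (xs ∷ʳ y)
  linked-++⁻ˡ []           _        = [-]
  linked-++⁻ˡ (_ ∷ [])     (Rx ∷ _) = Rx ∷ [-]
  linked-++⁻ˡ (_ ∷ x ∷ xs) (Rx ∷ l) = Rx ∷ linked-++⁻ˡ (x ∷ xs) l

  linked-++⁻ʳ : ∀ xs {ys} → Linked R (xs ++ ys) → Linked R ys
  linked-++⁻ʳ []       l = l
  linked-++⁻ʳ (x ∷ xs) l = linked-++⁻ʳ xs (Linked.tail l)

  linked-reverse : Symmetric R → ∀ {xs} → Linked R xs → Linked R (reverse xs)
  linked-reverse sy []  = []
  linked-reverse sy [-] = [-]
  linked-reverse sy (_∷_ {x} {y} {xs} Rxy l) =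
    subst (Linked R) (sym eq) (linked-++ (reverse xs)
      (subst (Linked R) (unfold-reverse y xs) (linked-reverse sy l)) (sy Rxy ∷ [-]))
    where
    eq : reverse (x ∷ y ∷ xs) ≡ reverse xs ++ y ∷ x ∷ []
    eq = begin
      reverse (x ∷ y ∷ xs)        ≡⟨ unfold-reverse x (y ∷ xs) ⟩
      reverse (y ∷ xs) ∷ʳ x       ≡⟨ cong (_∷ʳ x) (unfold-reverse y xs) ⟩
      (reverse xs ∷ʳ y) ∷ʳ x      ≡⟨ ∷ʳ-++ (reverse xs) y (x ∷ []) ⟩
      reverse xs ++ y ∷ x ∷ []    ∎
      where open ≡-Reasoning

unique-↭ : ∀ {xs ys : List A} → xs ↭ ys → Unique xs → Unique ys
unique-↭ p = Unique-resp-↭ (setoid _) (↭⇒↭ₛ p)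

unique-repeat : ∀ xs {y : A} ys {zs} → ¬ Unique (xs ++ y ∷ ys ++ y ∷ zs)
unique-repeat []       ys (y∉ ∷ _) = All.lookup y∉ (∈-insert ys) refl
unique-repeat (_ ∷ xs) ys (_ ∷ u)  = unique-repeat xs ys u

-- Pigeonhole: the entries are distinct, so `lookup xs` embeds the positions of the list in `Fin n`.
unique-length : ∀ {xs : List (Fin n)} → Unique xs → length xs ≤ n
unique-length {xs = xs} u = injective⇒≤ {f = lookup xs} inj
  where
  u′ : Unique (tabulate (lookup xs))
  u′ = subst Unique (sym (tabulate-lookup xs)) u

  inj : ∀ {i j} → lookup xs i ≡ lookup xs j → i ≡ j
  inj {i} {j} eq with <-cmp i j
  ... | tri< i<j _ _ = contradiction eq (allPairs-lookup u′ i<j)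
  ... | tri≈ _ i≡j _ = i≡j
  ... | tri> _ _ i>j = contradiction (sym eq) (allPairs-lookup u′ i>j)

-- If every vertex occurred in `xs`, its position there would embed `Fin n` in the shorter
-- `Fin (length xs)`.
missing-vertex : ∀ (xs : List (Fin n)) → length xs < n → ∃[ v ] v ∉ xs
missing-vertex xs short = ¬∀⟶∃¬ _ (_∈ xs) (λ v → _∈?_ _≟_ v xs) λ all →
  <⇒≱ short (injective⇒≤ λ {i} {j} → index-injective (setoid _) (all i) (all j))

-- Fixing the length makes the search finite; this is used to decide extendability.
any-list? : ∀ k {P : Pred (List (Fin n)) p} → Decidable P → Dec (∃[ xs ] length xs ≡ k × P xs)
any-list? zero    P? = map′ (λ p → [] , refl , p) (λ { ([] , _ , p) → p }) (P? [])
any-list? (suc k) P? = map′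
  (λ (x , xs , len , p) → x ∷ xs , cong suc len , p)
  (λ { (x ∷ xs , len , p) → x , xs , suc-injective len , p })
  (any? λ x → any-list? k (P? ∘ (x ∷_)))

-- The witnesses `z` and `ps` do not depend on `ys`, so one decomposition serves a list before and
-- after its tail is replaced.
prefix-cons : ∀ (xs : List A) y → ∃₂ λ z ps → ∀ ys → xs ++ y ∷ ys ≡ z ∷ ps ++ ys
prefix-cons []       y = y , [] , λ _ → refl
prefix-cons (x ∷ xs) y = x , xs ∷ʳ y , λ ys → cong (x ∷_) (sym (∷ʳ-++ xs y ys))

suffix-snoc : ∀ (x : A) xs → ∃₂ λ qs z → x ∷ xs ≡ qs ∷ʳ z
suffix-snoc x []       = [] , x , refl
suffix-snoc x (y ∷ ys) = let qs , z , eq = suffix-snoc y ys in x ∷ qs , z , cong (x ∷_) eq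

-- The consecutive pair s s′ precedes the consecutive pair t t′ in l, possibly with s′ and t the
-- same entry; M is the stretch from s′ to t.
Before : List A → (s s′ t t′ : A) → Set _
Before l s s′ t t′ = ∃[ xs ] ∃[ M ] ∃[ ys ] l ≡ xs ++ s ∷ M ++ t′ ∷ ys
                       × (∃[ M₀ ] M ≡ s′ ∷ M₀) × (∃[ M₁ ] M ≡ M₁ ∷ʳ t)

before-∷ : ∀ {l} {x s s′ t t′ : A} → Before l s s′ t t′ → Before (x ∷ l) s s′ t t′
before-∷ {x = x} (xs , M , ys , eq , ends) = x ∷ xs , M , ys , cong (x ∷_) eq , ends

consecutive-before : ∀ {l} {s s′ t t′ : A} {ys} xs {ys′} → l ≡ s ∷ s′ ∷ ys → l ≡ xs ++ t ∷ t′ ∷ ys′ →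
                     s ≢ t → Before l s s′ t t′
consecutive-before []           refl refl s≢s = contradiction refl s≢s
consecutive-before (_ ∷ [])     refl refl _ = [] , _ , _ , refl , ([] , refl) , ([] , refl)
consecutive-before {s = s} {t = t} (_ ∷ x ∷ xs) refl refl _ =
  [] , x ∷ xs ∷ʳ t , _ , cong (λ l → s ∷ x ∷ l) (sym (∷ʳ-++ xs t _)) , (_ , refl) , (x ∷ xs , refl)

-- Common entries are stripped from both prefixes; the pair whose prefix runs out first comes first.
consecutive-ordered : ∀ {l} {s s′ t t′ : A} xs {ys} xs′ {ys′} →
                      l ≡ xs ++ s ∷ s′ ∷ ys → l ≡ xs′ ++ t ∷ t′ ∷ ys′ → s ≢ t →
                      Before l s s′ t t′ ⊎ Before l t t′ s s′
consecutive-ordered []       xs′        e e′ s≢t = inj₁ (consecutive-before xs′ e e′ s≢t)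
consecutive-ordered (x ∷ xs) []         e e′ s≢t = inj₂ (consecutive-before (x ∷ xs) e′ e (s≢t ∘ sym))
consecutive-ordered (x ∷ xs) (x′ ∷ xs′) refl e′ s≢t =
  Sum.map before-∷ before-∷ (consecutive-ordered xs xs′ refl (∷-injectiveʳ e′) s≢t)

-- Recognising induced subgraphs pair by pair.

record Matches {m} {V : Set} (H : Graph (Fin m)) (G : Graph V) (f : Fin m → V) (i j : Fin m) : Set where
  constructor _,_
  field
    injective  : f i ≢ f j
    equivalent : Adj H i j ⇔ Adj G (f i) (f j)

open Matches

module _ {m} {V : Set} {H : Graph (Fin m)} {G : Graph V} {f : Fin m → V} where

  -- Adjacency in `H` is settled by evaluating `Adj?`, so only facts about `G` need to be supplied;
  -- an edge of `G` already separates its ends.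
  edge : ∀ {i j} {h : True (Adj? H i j)} → Adj G (f i) (f j) → Matches H G f i j
  edge {h = h} g = (λ eq → irrefl G eq g) , mk⇔ (λ _ → g) (λ _ → toWitness h)

  nonEdge : ∀ {i j} {h : False (Adj? H i j)} → f i ≢ f j → ¬ Adj G (f i) (f j) → Matches H G f i j
  nonEdge {h = h} ne ng = ne , mk⇔ (λ a → contradiction a (toWitnessFalse h)) (λ a → contradiction a ng)

  -- Both fields of `Matches` are symmetric in `i` and `j`, so checking the pairs with `i` below `j`
  -- suffices.
  induced : AllPairs (Matches H G f) (allFin m) → H ⊑ G
  induced ms = f , f-inj _ _ , equiv
    where
    f-inj : ∀ i j → f i ≡ f j → i ≡ j
    f-inj i j eq with <-cmp i j
    ... | tri< i<j _ _ = contradiction eq (injective (allPairs-lookup ms i<j))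
    ... | tri≈ _ i≡j _ = i≡j
    ... | tri> _ _ i>j = contradiction (sym eq) (injective (allPairs-lookup ms i>j))

    equiv : ∀ i j → Adj H i j ⇔ Adj G (f i) (f j)
    equiv i j with <-cmp i j
    ... | tri< i<j _ _  = equivalent (allPairs-lookup ms i<j)
    ... | tri≈ _ refl _ = mk⇔ (λ a → contradiction a (irrefl H refl)) (λ a → contradiction a (irrefl G refl))
    ... | tri> _ _ i>j  = mk⇔ (symm G ∘ to ∘ symm H) (symm H ∘ from ∘ symm G)
      where open Equivalence (equivalent (allPairs-lookup ms i>j))

module _ (G : Graph (Fin n)) where

  private
    infix 4 _~_ _≁_
    _~_ _≁_ : Rel (Fin n) _
    u ~ v = Adj G u v
    u ≁ v = ¬ u ~ v

  ~⇒≢ : ∀ {u v} → u ~ v → u ≢ v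
  ~⇒≢ uv u≡v = irrefl G u≡v uv

  K₁+P₄-induced : ∀ {u a b c d} → u ~ a → u ~ b → u ~ c → u ~ d →
                  a ~ b → b ~ c → c ~ d → a ≁ c → a ≁ d → b ≁ d → K₁+P₄ ⊑ G
  K₁+P₄-induced {u} {a} {b} {c} {d} ua ub uc ud ab bc cd ¬ac ¬ad ¬bd =
    induced {H = K₁+P₄} {G = G} {f = lookup (u ∷ a ∷ b ∷ c ∷ d ∷ [])}
    ( (edge ua ∷ edge ub ∷ edge uc ∷ edge ud ∷ [])
    -- Non-adjacent vertices of the path are distinct: identifying two of them would turn an edge of
    -- the path into a forbidden chord.
    ∷ (edge ab ∷ nonEdge (λ { refl → ¬ad cd }) ¬ac ∷ nonEdge (λ { refl → ¬ac (symm G cd) }) ¬ad ∷ [])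
    ∷ (edge bc ∷ nonEdge (λ { refl → ¬ad ab }) ¬bd ∷ [])
    ∷ (edge cd ∷ [])
    ∷ [] ∷ [])

  K₁,₁,₃-induced : ∀ {u v a b c} → u ~ v → u ~ a → u ~ b → u ~ c → v ~ a → v ~ b → v ~ c →
                   a ≢ b → a ≢ c → b ≢ c → a ≁ b → a ≁ c → b ≁ c → K₁,₁,₃ ⊑ G
  K₁,₁,₃-induced {u} {v} {a} {b} {c} uv ua ub uc va vb vc a≢b a≢c b≢c ¬ab ¬ac ¬bc =
    induced {H = K₁,₁,₃} {G = G} {f = lookup (u ∷ v ∷ a ∷ b ∷ c ∷ [])}
    ( (edge uv ∷ edge ua ∷ edge ub ∷ edge uc ∷ [])
    ∷ (edge va ∷ edge vb ∷ edge vc ∷ [])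
    ∷ (nonEdge a≢b ¬ab ∷ nonEdge a≢c ¬ac ∷ [])
    ∷ (nonEdge b≢c ¬bc ∷ [])
    ∷ [] ∷ [])

  -- Short walks inside a neighbourhood.

  module _ {w : Fin n} where

    -- The refinement stores this proof irrelevantly; deciding adjacency recovers it.
    adjacent : ∀ (v : Refinement (Fin n) (N G w)) → w ~ value v
    adjacent (v , irr wv) = recompute (Adj? G w v) wv

    triangle-step : ∀ {u v} → Star (Adj (G [ N G w ])) u v → value u ≢ value v →
                    ∃[ z ] w ~ z × value u ~ z
    triangle-step ε                 u≢u = contradiction refl u≢u
    triangle-step (_◅_ {j = z} uz _) _  = value z , adjacent z , uz

    -- Induction on the walk: the part from `c` to `b` shortens to at most two steps, and a
    -- resulting path `a c d b` without chords would form `K₁+P₄` with `w`.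
    diameter≤2 : ¬ K₁+P₄ ⊑ G → ∀ {a b} → Star (Adj (G [ N G w ])) a b →
           value a ≡ value b ⊎ value a ~ value b ⊎ ∃[ c ] w ~ c × value a ~ c × c ~ value b
    diameter≤2 free ε = inj₁ refl
    diameter≤2 free {a} {b} (_◅_ {j = c} ac c⋯b) with diameter≤2 free c⋯b
    ... | inj₁ refl                     = inj₂ (inj₁ ac)
    ... | inj₂ (inj₁ cb)                = inj₂ (inj₂ (value c , adjacent c , ac , cb))
    ... | inj₂ (inj₂ (d , wd , cd , db)) with Adj? G (value a) (value b) | Adj? G (value a) d | Adj? G (value c) (value b)
    ... | yes ab | _      | _      = inj₂ (inj₁ ab)
    ... | no _   | yes ad | _      = inj₂ (inj₂ (d , wd , ad , db))
    ... | no _   | no _   | yes cb = inj₂ (inj₂ (value c , adjacent c , ac , cb))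
    ... | no ¬ab | no ¬ad | no ¬cb = contradiction
      (K₁+P₄-induced (adjacent a) (adjacent c) wd (adjacent b) ac cd db ¬ad ¬ab ¬cb) free

  common-neighbour : ¬ K₁+P₄ ⊑ G → LocallyConnected G → ∀ {w a b} → w ~ a → w ~ b → a ≢ b → a ≁ b →
                     ∃[ c ] w ~ c × a ~ c × c ~ b
  common-neighbour free lc {w} wa wb a≢b ¬ab with diameter≤2 free (lc w (_ , irr wa) (_ , irr wb))
  ... | inj₁ a≡b      = contradiction a≡b a≢b
  ... | inj₂ (inj₁ ab) = contradiction ab ¬ab
  ... | inj₂ (inj₂ c) = c

  -- Edges leaving a vertex set, and triangles.

  boundary-edge : Connected G → ∀ {u} xs → length xs < n → u ∈ xs → ∃₂ λ a b → a ∈ xs × b ∉ xs × a ~ b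
  boundary-edge conn xs short u∈xs = let w , w∉xs = missing-vertex xs short in leave u∈xs w∉xs (conn _ w)
    where
    -- The walk is followed to its first step out of `xs`.
    leave : ∀ {u w} → u ∈ xs → w ∉ xs → Star _~_ u w → ∃₂ λ a b → a ∈ xs × b ∉ xs × a ~ b
    leave u∈ w∉ ε = contradiction u∈ w∉
    leave u∈ w∉ (_◅_ {j = v} uv v⋯w) with _∈?_ _≟_ v xs
    ... | yes v∈ = leave v∈ w∉ v⋯w
    ... | no v∉  = _ , v , u∈ , v∉ , uv

  triangle : ∀ {u v w} → u ~ v → v ~ w → w ~ u → OnTriangle G u
  triangle {u} {v} {w} uv vw wu = record
    { start    = u
    ; rest     = v ∷ w ∷ []
    ; order≥3  = ≤-refl
    ; distinct = (~⇒≢ uv ∷ ~⇒≢ wu ∘ sym ∷ []) ∷ (~⇒≢ vw ∷ []) ∷ [] ∷ []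
    ; closed   = uv ∷ vw ∷ wu ∷ [-]
    } , refl , here refl

  -- Take an edge `uv` and a third vertex `w` adjacent to one of its ends. The neighbourhood of that
  -- end contains `w` and the other end; being connected, it gives the other end a neighbour, which
  -- closes a triangle on `uv`.
  onTriangle : 3 ≤ n → Connected G → LocallyConnected G → ∀ u → OnTriangle G u
  onTriangle n≥3 conn lc u with boundary-edge conn (u ∷ []) (≤-trans (s≤s (s≤s z≤n)) n≥3) (here refl)
  ... | u , v , here refl , _ , uv with boundary-edge conn (u ∷ v ∷ []) n≥3 (here refl)
  ... | _ , w , here refl , w∉ , uw
        with z , uz , vz ← triangle-step (lc u (v , irr uv) (w , irr uw)) (λ { refl → w∉ (there (here refl)) })
        = triangle uv vz (symm G uz)
  ... | _ , w , there (here refl) , w∉ , vw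
        with z , vz , uz ← triangle-step (lc v (u , irr (symm G uv)) (w , irr vw)) (λ { refl → w∉ (here refl) })
        = triangle uv vz (symm G uz)

  -- Deciding extendability.

  extendable? : (C : Cycle G) → Dec (Extendable C)
  extendable? C = map′ toExtension fromExtension
    (any? λ a → any-list? (order C) λ xs →
      (3 ≤? length (a ∷ xs)) ×-dec unique? _≟_ (a ∷ xs) ×-dec linked? (Adj? G) (a ∷ xs ∷ʳ a)
        ×-dec (_⊆?_ _≟_ (vertices C) (a ∷ xs)))
    where
    -- The start `a` is counted apart from `xs`, so `order C` entries in `xs` make a cycle with one
    -- vertex more than `C`.
    Extension : Set
    Extension = ∃[ a ] ∃[ xs ] length xs ≡ order C × 3 ≤ length (a ∷ xs) × Unique (a ∷ xs)
                  × Linked _~_ (a ∷ xs ∷ʳ a) × vertices C ⊆ a ∷ xs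

    toExtension : Extension → Extendable C
    toExtension (a , xs , len , ord , dis , clo , sub) =
      record { start = a ; rest = xs ; order≥3 = ord ; distinct = dis ; closed = clo } , cong suc len , sub

    fromExtension : Extendable C → Extension
    fromExtension (C′ , len , sub) = start , rest , suc-injective len , order≥3 , distinct , closed , sub
      where open Cycle C′ using (start; rest; order≥3; distinct; closed)

  -- Arcs of a cycle and rerouting.

  module _ (C : Cycle G) where
    open Cycle C using (start; rest; order≥3; distinct; closed)

    -- Repeating `start` at the end makes the arc from the last vertex back to `start` a consecutive
    -- pair like any other.
    closure : List (Fin n)
    closure = vertices C ∷ʳ start

    Arc : Rel (Fin n) _
    Arc s t = ∃₂ λ xs ys → closure ≡ xs ++ s ∷ t ∷ ys

    -- `M` lies strictly between `s` and `t`, so it contains neither the first nor the last entry of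
    -- `closure`. Both copies of `start` thus survive when any `L` replaces `M`.
    closure-split : ∀ xs {s} M {t} ys → closure ≡ xs ++ s ∷ M ++ t ∷ ys →
                    ∃₂ λ ps qs → vertices C ≡ start ∷ ps ++ M ++ qs
                               × (∀ L → xs ++ s ∷ L ++ t ∷ ys ≡ (start ∷ ps ++ L ++ qs) ∷ʳ start)
    closure-split xs {s} M {t} ys eq =
      let z , ps , pre = prefix-cons xs s
          qs , z′ , suf = suffix-snoc t ys
          regroup = λ L → begin
            xs ++ s ∷ (L ++ t ∷ ys)         ≡⟨ pre (L ++ t ∷ ys) ⟩
            z ∷ (ps ++ (L ++ t ∷ ys))       ≡⟨ cong (λ l → z ∷ ps ++ (L ++ l)) suf ⟩
            z ∷ (ps ++ (L ++ (qs ∷ʳ z′)))   ≡⟨ cong (λ l → z ∷ ps ++ l) (++-assoc L qs _) ⟨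
            z ∷ (ps ++ ((L ++ qs) ∷ʳ z′))   ≡⟨ cong (z ∷_) (++-assoc ps (L ++ qs) _) ⟨
            (z ∷ ps ++ L ++ qs) ∷ʳ z′       ∎
          vs≡ , start≡z′ = ∷ʳ-injective (vertices C) (z ∷ ps ++ M ++ qs) (trans eq (regroup M))
          start≡z = ∷-injectiveˡ vs≡
      in ps , qs , trans vs≡ (cong (_∷ ps ++ M ++ qs) (sym start≡z)) ,
         λ L → trans (regroup L) (cong₂ (λ a b → (a ∷ ps ++ L ++ qs) ∷ʳ b) (sym start≡z) (sym start≡z′))
      where open ≡-Reasoning

    -- The new vertex list is a permutation of `x ∷ vertices C`, which yields order, distinctness
    -- and containment at once. Insertion and crossing are both instances.
    reroute : ∀ xs {s} M M′ {t} ys {x} → closure ≡ xs ++ s ∷ M ++ t ∷ ys →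
              M′ ↭ x ∷ M → x ∉ vertices C → Linked _~_ (s ∷ M′ ++ t ∷ []) → Extendable C
    reroute xs {s} M M′ {t} ys {x} eq M′↭ x∉ linked = C′ , sym (↭-length perm) , ∈-resp-↭ perm ∘ there
      where
      ps = proj₁ (closure-split xs M ys eq)
      qs = proj₁ (proj₂ (closure-split xs M ys eq))
      vs≡ = proj₁ (proj₂ (proj₂ (closure-split xs M ys eq)))
      regroup = proj₂ (proj₂ (proj₂ (closure-split xs M ys eq)))

      perm : x ∷ vertices C ↭ start ∷ ps ++ M′ ++ qs
      perm = subst (λ l → x ∷ l ↭ start ∷ ps ++ M′ ++ qs) (sym vs≡)
        (↭-sym (↭-trans (zoom (start ∷ ps) M′↭) (shift x (start ∷ ps) (M ++ qs))))

      old : Linked _~_ (xs ++ s ∷ M ++ t ∷ ys)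
      old = subst (Linked _~_) eq closed

      C′ : Cycle G
      C′ = record
        { start    = start
        ; rest     = ps ++ M′ ++ qs
        ; order≥3  = subst (3 ≤_) (↭-length perm) (m≤n⇒m≤1+n order≥3)
        ; distinct = unique-↭ perm (All.¬Any⇒All¬ _ x∉ ∷ distinct)
        ; closed   = subst (Linked _~_) (regroup M′) (linked-++ xs (linked-++⁻ˡ xs old)
                       (linked-++ (s ∷ M′) linked (linked-++⁻ʳ (s ∷ M) (linked-++⁻ʳ xs old))))
        }

    arc-from : ∀ {s} → s ∈ vertices C → ∃[ t ] Arc s t
    -- The successor is the first entry of `ys`, or `start` when `s` is the last vertex.
    arc-from {s} s∈ with xs , ys , eq ← ∈-∃++ s∈ with t , zs , cons ← prefix-cons ys start =
      t , xs , zs ++ [] , (begin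
        vertices C ∷ʳ start       ≡⟨ cong (_∷ʳ start) eq ⟩
        (xs ++ s ∷ ys) ∷ʳ start   ≡⟨ ++-assoc xs (s ∷ ys) _ ⟩
        xs ++ s ∷ (ys ∷ʳ start)   ≡⟨ cong (λ l → xs ++ s ∷ l) (cons []) ⟩
        xs ++ s ∷ t ∷ (zs ++ [])  ∎)
      where open ≡-Reasoning

    arc-~ : ∀ {s t} → Arc s t → s ~ t
    arc-~ (xs , _ , eq) = Linked.head (linked-++⁻ʳ xs (subst (Linked _~_) eq closed))

    arc-head-∈ : ∀ {s t} → Arc s t → t ∈ vertices C
    arc-head-∈ {t = t} (xs , _ , eq) with ∈-++⁻ (vertices C) (subst (t ∈_) (sym eq) (∈-++⁺ʳ xs (there (here refl))))
    ... | inj₁ t∈         = t∈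
    ... | inj₂ (here t≡)  = here t≡

    insert-between : ∀ {x s t} → x ∉ vertices C → Arc s t → s ~ x → x ~ t → Extendable C
    insert-between x∉ (xs , ys , eq) sx xt = reroute xs [] (_ ∷ []) ys eq ↭-refl x∉ (sx ∷ xt ∷ [-])

    -- Without its first entry, `closure` is a permutation of the vertices of `C` and hence free of
    -- repetitions; `s′` and `t′` occupy two different positions in it.
    before-heads-≢ : ∀ {s s′ t t′} → Before closure s s′ t t′ → s′ ≢ t′
    before-heads-≢ {s} {s′} (xs , _ , ys , eq , (M , refl) , _) refl with z , ps , pre ← prefix-cons xs s =
      unique-repeat ps M (subst Unique (∷-injectiveʳ (trans eq (pre (s′ ∷ M ++ s′ ∷ ys))))
        (unique-↭ (∷↭∷ʳ start rest) distinct))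

    arc-heads-≢ : ∀ {s s′ t t′} → Arc s s′ → Arc t t′ → s ≢ t → s′ ≢ t′
    arc-heads-≢ (xs , _ , eq) (xs′ , _ , eq′) s≢t with consecutive-ordered xs xs′ eq eq′ s≢t
    ... | inj₁ b = before-heads-≢ b
    ... | inj₂ b = before-heads-≢ b ∘ sym

    -- From … s s′ … t t′ … to … s x t … s′ t′ …, with the segment s′ … t reversed.
    cross-before : ∀ {x s s′ t t′} → x ∉ vertices C → Before closure s s′ t t′ →
                   s ~ x → t ~ x → s′ ~ t′ → Extendable C
    cross-before {x} {s} {s′} {t} {t′} x∉ (xs , M , ys , eq , (M₀ , M≡s′∷) , (M₁ , M≡∷ʳt)) sx tx s′t′ =
      reroute xs M (x ∷ reverse M) ys eq (prep x (↭-reverse M)) x∉ (sx ∷ x-to-t′)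
      where
      reverse-tail : reverse M ≡ reverse M₀ ∷ʳ s′
      reverse-tail = trans (cong reverse M≡s′∷) (unfold-reverse s′ M₀)

      reverse-head : reverse M ≡ t ∷ reverse M₁
      reverse-head = trans (cong reverse M≡∷ʳt) (reverse-++ M₁ (t ∷ []))

      M-linked : Linked _~_ M
      M-linked = subst (Linked _~_) (sym M≡∷ʳt) (linked-++⁻ˡ M₁ (subst (Linked _~_)
        (trans (cong (_++ t′ ∷ ys) M≡∷ʳt) (∷ʳ-++ M₁ t (t′ ∷ ys)))
        (Linked.tail (linked-++⁻ʳ xs (subst (Linked _~_) eq closed)))))

      t-to-t′ : Linked _~_ (reverse M ++ t′ ∷ [])
      t-to-t′ = subst (Linked _~_) (sym (trans (cong (_∷ʳ t′) reverse-tail) (∷ʳ-++ (reverse M₀) s′ (t′ ∷ []))))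
        (linked-++ (reverse M₀) (subst (Linked _~_) reverse-tail (linked-reverse (symm G) M-linked)) (s′t′ ∷ [-]))

      x-to-t′ : Linked _~_ (x ∷ reverse M ++ t′ ∷ [])
      x-to-t′ = subst (λ l → Linked _~_ (x ∷ l ++ t′ ∷ [])) (sym reverse-head)
        (symm G tx ∷ subst (λ l → Linked _~_ (l ++ t′ ∷ [])) reverse-head t-to-t′)

    cross : ∀ {x s s′ t t′} → x ∉ vertices C → Arc s s′ → Arc t t′ → s ≢ t →
            s ~ x → t ~ x → s′ ~ t′ → Extendable C
    cross x∉ (xs , _ , eq) (xs′ , _ , eq′) s≢t sx tx s′t′ with consecutive-ordered xs xs′ eq eq′ s≢t
    ... | inj₁ b = cross-before x∉ b sx tx s′t′
    ... | inj₂ b = cross-before x∉ b tx sx (symm G s′t′)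

    -- Growing towers from a neighbour of `x` on the cycle.

    module _ (lc : LocallyConnected G) (free₁ : ¬ K₁,₁,₃ ⊑ G) (free₂ : ¬ K₁+P₄ ⊑ G)
             (stuck : ¬ Extendable C) {x} (x∉ : x ∉ vertices C) where

      ArcAtNeighbour : Pred (Fin n × Fin n) _
      ArcAtNeighbour (s , s′) = Arc s s′ × s ~ x

      infix 4 _▷_
      -- The left pair is the one added later. The condition `w′ ≁ s` excludes a chord from both
      -- paths considered in `grow`.
      _▷_ : Rel (Fin n × Fin n) _
      (w , w′) ▷ (s , s′) = w ~ s × w ~ s′ × w′ ≁ s

      ∉⇒≢ : ∀ {v} → v ∈ vertices C → x ≢ v
      ∉⇒≢ v∈ refl = x∉ v∈

      head-≁ : ∀ {s s′} → ArcAtNeighbour (s , s′) → x ≁ s′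
      head-≁ (arc , sx) xs′ = stuck (insert-between x∉ arc sx xs′)

      heads-≁ : ∀ {s s′ t t′} → ArcAtNeighbour (s , s′) → ArcAtNeighbour (t , t′) → s ≢ t → s′ ≁ t′
      heads-≁ (sArc , sx) (tArc , tx) s≢t s′t′ = stuck (cross x∉ sArc tArc s≢t sx tx s′t′)

      -- Inserting `x` or crossing at `x` is impossible, so `x`, `s′` and `v′` are independent;
      -- adjacency of `v′` and `s` would make all three common neighbours of the adjacent `s` and
      -- `v`.
      head-≁-tail : ∀ {s s′ v v′} → ArcAtNeighbour (s , s′) → ArcAtNeighbour (v , v′) →
                    v ~ s → v ~ s′ → v′ ≁ s
      head-≁-tail s@(sArc , sx) v@(vArc , vx) vs vs′ v′s = free₁
        (K₁,₁,₃-induced (symm G vs) sx (arc-~ sArc) (symm G v′s) vx vs′ (arc-~ vArc)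
          (∉⇒≢ (arc-head-∈ sArc)) (∉⇒≢ (arc-head-∈ vArc)) (arc-heads-≢ sArc vArc (~⇒≢ vs ∘ sym))
          (head-≁ s) (head-≁ v) (heads-≁ s v (~⇒≢ vs ∘ sym)))

      Tower : Pred (List (Fin n × Fin n)) _
      Tower as = All ArcAtNeighbour as × AllPairs _▷_ as

      grow : ∀ {w as} → Tower (w ∷ as) → ∃[ v ] Tower (v ∷ w ∷ as)
      grow {w , w′} {as} (good@(w-arc@(wArc , wx) ∷ goods) , pairs@(w▷ ∷ _))
        with v , wv , xv , vw′ ← common-neighbour free₂ lc wx (arc-~ wArc) (∉⇒≢ (arc-head-∈ wArc)) (head-≁ w-arc)
        with _∈?_ _≟_ v (vertices C)
      -- Here `v` itself, rather than `x`, is the vertex that extends the cycle.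
      ... | no v∉ = contradiction (insert-between v∉ wArc wv vw′) stuck
      ... | yes v∈ with v′ , vArc ← arc-from v∈ =
        (v , v′) , v-arc ∷ good , (v▷w ∷ All.zipWith v▷ (goods , w▷)) ∷ pairs
        where
        v-arc : ArcAtNeighbour (v , v′)
        v-arc = vArc , symm G xv

        v▷w : (v , v′) ▷ (w , w′)
        v▷w = symm G wv , vw′ , head-≁-tail w-arc v-arc (symm G wv) vw′

        v▷ : ∀ {a} → ArcAtNeighbour a × (w , w′) ▷ a → (v , v′) ▷ a
        v▷ {s , s′} (s-arc@(sArc , sx) , ws , ws′ , w′≁s) = vs , vs′ , head-≁-tail s-arc v-arc vs vs′
          where
          vs : v ~ s
          vs = decidable-stable (Adj? G v s) λ v≁s → free₂
            (K₁+P₄-induced ws wx wv (arc-~ wArc) sx xv vw′ (v≁s ∘ symm G) (w′≁s ∘ symm G) (head-≁ w-arc))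

          vs′ : v ~ s′
          vs′ = decidable-stable (Adj? G v s′) λ v≁s′ → free₂
            -- The path `s′ s v w′` has its middle edge by the adjacency `vs` just obtained.
            (K₁+P₄-induced ws′ ws wv (arc-~ wArc) (symm G (arc-~ sArc)) (symm G vs) vw′
              (v≁s′ ∘ symm G) (heads-≁ s-arc w-arc (~⇒≢ ws ∘ sym)) (w′≁s ∘ symm G))

      towers : ∀ {s} → s ∈ vertices C → s ~ x → ∀ k → ∃₂ λ a as → Tower (a ∷ as) × length as ≡ k
      towers s∈ sx zero    = let s′ , arc = arc-from s∈ in _ , [] , ((arc , sx) ∷ [] , [] ∷ []) , refl
      towers s∈ sx (suc k) with a , as , tower , len ← towers s∈ sx k =
        let b , tower′ = grow tower in b , a ∷ as , tower′ , cong suc len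

      -- Each later vertex is adjacent to, hence distinct from, every earlier one.
      tower-length : ∀ {as} → Tower as → length as ≤ n
      tower-length {as} (_ , pairs) = subst (_≤ n) (length-map proj₁ as)
        (unique-length (AllPairs.map⁺ (AllPairs.map (~⇒≢ ∘ proj₁) pairs)))

      no-neighbour : ∀ {s} → s ∈ vertices C → s ≁ x
      -- With its head counted, this tower has `n` + 1 entries, one too many.
      no-neighbour s∈ sx with a , as , tower , len ← towers s∈ sx n =
        n≮n n (subst (λ k → suc k ≤ n) len (tower-length tower))

theorem6 : ∀ (n : ℕ) (G : Graph (Fin n)) → 3 ≤ n → Connected G → LocallyConnected G →
    ((｛ 5 , K₁,₁,₃ ｝ ∪ ｛ 5 , K₁+P₄ ｝) -Free) G → FullyCycleExtendable G
theorem6 n G n≥3 conn lc free = onTriangle G n≥3 conn lc , λ C short →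
  -- Extendability is decidable, so it suffices to refute that `C` is stuck.
  decidable-stable (extendable? G C) λ stuck →
    let s , x , s∈ , x∉ , sx = boundary-edge G conn (vertices C) short (here refl)
    in no-neighbour G C lc (free 5 K₁,₁,₃ (inj₁ refl)) (free 5 K₁+P₄ (inj₂ refl)) stuck x∉ s∈ sx
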